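{- Let $\mathcal G=((V,E),(V_1,V_2))$ be a game graph and $T_1,\dots,T_k\subseteq V$ target sets. Let $V^{j^*}$ be the set returned by Algorithm GenBuchiGame (described in the context) on input $\mathcal G$ and the generalized Büchi objective $\bigwedge_{1\le \ell\le k}\text{Büchi}(T_\ell)$ of player 1. Then player 2 has a winning strategy in $\mathcal G$ (for the complementary objective) from each vertex in $V\setminus V^{j^*}$.
   Context: **Games.** A game graph $\mathcal G=((V,E),(V_1,V_2))$ is a finite directed graph $(V,E)$, $E\subseteq V\times V$, with a partition of $V$ into player-1 vertices $V_1$ and player-2 vertices $V_2$; $n=|V|$, $m=|E|$. Every vertex has at least one outgoing edge. $\mathrm{Out}(u)$, $\mathrm{In}(u)$ are the sets of successors and predecessors of $u$, $\mathrm{Outdeg}(u)=|\mathrm{Out}(u)|$ (a graph is added as an argument if needed). A play is an infinite path; at a vertex of $V_p$ player $p$ chooses the successor via a strategy, a function of the finite history. $\mathrm{Inf}(\omega)$ is the set of vertices occurring infinitely often in the play $\omega$. $\bigwedge_{\ell}\text{Büchi}(T_\ell)$ is the set of plays with $\mathrm{Inf}(\omega)\cap T_\ell\ne\emptyset$ for all $1\le\ell\le k$. This is player 1's objective; player 2 has the complementary (disjunctive co-Büchi) objective: $\mathrm{Inf}(\omega)\cap T_\ell=\emptyset$ for some $\ell$. A strategy of a player is winning from $v$ if every play from $v$ consistent with it satisfies that player's objective. **Attractors.** For $p\in\{1,2\}$ with opponent $\bar p$ and $U\subseteq V$: $R_0=U$, $R_{j+1}=R_j\cup\{v\in V_p\mid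 \mathrm{Out}(v)\cap R_j\ne\emptyset\}\cup\{v\in V_{\bar p}\mid \mathrm{Out}(v)\subseteq R_j\}$, and $\mathit{Attr}_p(\mathcal G,U)=\bigcup_j R_j$. $\mathcal G\setminus X$ is the game graph induced by $V\setminus X$. **Hierarchical graph decomposition.** For a game graph on $G=(V,E)$, fix for each vertex an order of its incoming edges in which edges from $V_2$ precede edges from $V_1$. For $i\ge1$, $G_i=(V,E_i)$, where $E_i$ contains all outgoing edges of every $v$ with $\mathrm{Outdeg}(G,v)\le 2^i$ and the first $2^i$ incoming edges of every vertex. $\mathcal G_i=(G_i,(V_1,V_2))$. **Algorithm GenBuchiGame.** Let $n=|V|$ be the number of vertices of the input and let $I$ be the least integer $I\ge 1$ with $2^I\ge n$. Set $\mathcal G^1=\mathcal G$, $T^1_\ell=T_\ell$. For $j=1,2,\dots$: let $G^j$ be the graph of $\mathcal G^j$, $V^j$ its vertex set. For $i=1,\dots,I$ (in this order): construct $G^j_i$ (the $i$th graph of the decomposition of $G^j$); let $Z^j_i=\{v\in V_2\cap V^j\mid \mathrm{Outdeg}(G^j_i,v)=0\}\cup\{v\in V_1\cap V^j\mid\mathrm{Outdeg}(G^j,v)>2^i\}$; for $\ell=1,\dots,k$: let $Y^j_{\ell,i}=\mathit{Attr}_1(\mathcal G^j_i,T^j_\ell\cup Z^j_i)$ and $S^j=V^j\setminus Y^j_{\ell,i}$; if $S^j\neq\emptyset$, leave both loops. Then let $D^j=\mathit{Attr}_2(\mathcal G^j,S^j)$, $\mathcal G^{j+1}=\mathcal G^j\setminus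 D^j$, $T^{j+1}_\ell=T^j_\ell\setminus D^j$. If $D^j=\emptyset$, stop and return $V^j$ (this $j$ is denoted $j^*$). -}

module Defs where

open import Data.Fin.Base using (Fin)
open import Data.Fin.Properties using (_≟_)
open import Data.Fin.Subset
  using (Subset; _∈_; _∉_; _⊆_; _∩_; _∪_; _─_; ∣_∣; Nonempty; Empty; ⊥)
open import Data.Fin.Subset.Properties
  using ( _∈?_; _⊆?_; nonempty?; ⊆-antisym; p⊂q⇒∣p∣<∣q∣; ∣p∣≤n; p⊆p∪q; x∈p∪q⁻
        ; p─q⊆p; x∈p∧x∉q⇒x∈p─q; ∉⊥; x∈p∩q⁺; p∩q≢∅⇒∣p─q∣<∣p∣)
open import Data.List.Base
  using (List; []; _∷_; take; applyUpTo; allFin; cartesianProductWith)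
open import Data.List.Membership.Propositional using () renaming (_∈_ to _∈ₗ_)
open import Data.List.Membership.DecPropositional using () renaming (_∈?_ to ∈ₗ-dec)
open import Data.List.Relation.Unary.All using (All; []; _∷_)
open import Data.List.Relation.Unary.All.Properties using (cartesianProductWith⁺)
open import Data.List.Relation.Unary.AllPairs using (AllPairs)
open import Data.List.Relation.Unary.Unique.Propositional using (Unique)
open import Data.Nat.Base
open import Data.Nat.Properties as ℕ using (_≤?_; _<?_)
open import Data.Nat.Induction using (<-rec)
open import Data.Nat.Logarithm using (⌈log₂_⌉; ⌈log₂⌉-mono-≤; ⌈log₂2^n⌉≡n; ⌈log₂⌈n/2⌉⌉≡⌈log₂n⌉∸1)
open import Data.Product.Base using (_×_; _,_; ∃; proj₁)
open import Data.Sum.Base using (_⊎_; inj₁; inj₂)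
open import Data.Vec.Base using (tabulate)
open import Data.Vec.Properties using (lookup∘tabulate; lookup⇒[]=; []=⇒lookup)
open import Function.Base using (_∘_)
open import Function.Bundles using (_⇔_; mk⇔)
open import Level using (0ℓ)
open import Relation.Binary.PropositionalEquality
open import Relation.Nullary using (Dec; yes; no; does; contradiction)
open import Relation.Nullary.Decidable using (_×-dec_; _⊎-dec_; ¬?; dec-true)
open import Relation.Unary using (Pred; Decidable)
import Relation.Unary as U

----------------------------------------------------------------------
-- Finite sets given by decidable predicates

subset : ∀ {N} {P : Pred (Fin N) 0ℓ} → Decidable P → Subset N
subset P? = tabulate (does ∘ P?)

∈-subset⁺ : ∀ {N} {P : Pred (Fin N) 0ℓ} (P? : Decidable P) {v} → P v → v ∈ subset P?
∈-subset⁺ P? {v} p =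
  lookup⇒[]= v _ (trans (lookup∘tabulate (does ∘ P?) v) (dec-true (P? v) p))

∈-subset⁻ : ∀ {N} {P : Pred (Fin N) 0ℓ} (P? : Decidable P) {v} → v ∈ subset P? → P v
∈-subset⁻ P? {v} v∈ with P? v | trans (sym (lookup∘tabulate (does ∘ P?) v)) ([]=⇒lookup v∈)
... | yes p | _ = p
... | no  _ | ()

----------------------------------------------------------------------
-- Game graphs

data Player : Set where
  player₁ player₂ : Player

opponent : Player → Player
opponent player₁ = player₂
opponent player₂ = player₁

_≟ₚ_ : (p q : Player) → Dec (p ≡ q)
player₁ ≟ₚ player₁ = yes refl
player₁ ≟ₚ player₂ = no λ ()
player₂ ≟ₚ player₁ = no λ ()
player₂ ≟ₚ player₂ = yes refl

-- The vertex set is a subset of an ambient Fin N, so that subgraphs live on the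
-- same type as the graph they come from.  Absence of sinks is the separate
-- predicate NoSinks because the graphs of the hierarchical decomposition may
-- have sinks.
record GameGraph (N : ℕ) : Set where
  field
    V       : Subset N
    Out     : Fin N → Subset N
    owner   : Fin N → Player
    Out-dom : ∀ {u w} → w ∈ Out u → u ∈ V
    Out-cod : ∀ {u w} → w ∈ Out u → w ∈ V

  Owned : Player → Subset N
  Owned p = subset (λ v → (v ∈? V) ×-dec (owner v ≟ₚ p))

  In : Fin N → Subset N
  In w = subset (λ u → w ∈? Out u)

  Outdeg : Fin N → ℕ
  Outdeg u = ∣ Out u ∣

  NoSinks : Set
  NoSinks = ∀ {v} → v ∈ V → Nonempty (Out v)

open GameGraph

infixl 5 _∖_

keepEdge? : ∀ {N} (𝒢 : GameGraph N) (X : Subset N) (u : Fin N) →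
            Decidable (λ w → w ∈ Out 𝒢 u × u ∉ X × w ∉ X)
keepEdge? 𝒢 X u w = (w ∈? Out 𝒢 u) ×-dec ¬? (u ∈? X) ×-dec ¬? (w ∈? X)

_∖_ : ∀ {N} → GameGraph N → Subset N → GameGraph N
𝒢 ∖ X = record
  { V       = V 𝒢 ─ X
  ; Out     = λ u → subset (keepEdge? 𝒢 X u)
  ; owner   = owner 𝒢
  ; Out-dom = λ {u} e → let (e′ , u∉X , _) = ∈-subset⁻ (keepEdge? 𝒢 X u) e
                        in x∈p∧x∉q⇒x∈p─q (Out-dom 𝒢 e′) u∉X
  ; Out-cod = λ {u} e → let (e′ , _ , w∉X) = ∈-subset⁻ (keepEdge? 𝒢 X u) e
                        in x∈p∧x∉q⇒x∈p─q (Out-cod 𝒢 e′) w∉X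
  }

----------------------------------------------------------------------
-- Plays, strategies, objectives

record IsPlay {N} (𝒢 : GameGraph N) (v : Fin N) (ω : ℕ → Fin N) : Set where
  field
    start : ω 0 ≡ v
    step  : ∀ t → ω (suc t) ∈ Out 𝒢 (ω t)

-- move h u is the successor chosen at u after the vertices h have been visited,
-- i.e. for the finite history h followed by u.
record Strategy {N} (𝒢 : GameGraph N) (p : Player) : Set where
  field
    move  : List (Fin N) → Fin N → Fin N
    legal : ∀ h {u} → u ∈ Owned 𝒢 p → move h u ∈ Out 𝒢 u

Consistent : ∀ {N} {𝒢 : GameGraph N} {p} → Strategy 𝒢 p → (ℕ → Fin N) → Set
Consistent {𝒢 = 𝒢} {p} σ ω =
  ∀ t → ω t ∈ Owned 𝒢 p → ω (suc t) ≡ Strategy.move σ (applyUpTo ω t) (ω t)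

Inf : ∀ {N} → (ℕ → Fin N) → Pred (Fin N) 0ℓ
Inf ω v = ∀ t → ∃ λ s → t ≤ s × ω s ≡ v

GenBüchi : ∀ {N k} → (Fin k → Subset N) → Pred (ℕ → Fin N) 0ℓ
GenBüchi T ω = ∀ ℓ → U.Satisfiable (Inf ω U.∩ (_∈ T ℓ))

-- The complement of GenBüchi T only classically: no ℓ can be computed from ω.
DisjCoBüchi : ∀ {N k} → (Fin k → Subset N) → Pred (ℕ → Fin N) 0ℓ
DisjCoBüchi T ω = ∃ λ ℓ → U.Empty (Inf ω U.∩ (_∈ T ℓ))

Objective : ∀ {N k} → (Fin k → Subset N) → Player → Pred (ℕ → Fin N) 0ℓ
Objective T player₁ = GenBüchi T
Objective T player₂ = DisjCoBüchi T

WinningFrom : ∀ {N k} {𝒢 : GameGraph N} {p} →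
              (Fin k → Subset N) → Fin N → Strategy 𝒢 p → Set
WinningFrom {𝒢 = 𝒢} {p} T v σ =
  ∀ ω → IsPlay 𝒢 v ω → Consistent σ ω → Objective T p ω

----------------------------------------------------------------------
-- Attractors

module _ {N} (p : Player) (𝒢 : GameGraph N) where

  reach? : ∀ R → Decidable (λ v → v ∈ Owned 𝒢 p × Nonempty (Out 𝒢 v ∩ R))
  reach? R v = (v ∈? Owned 𝒢 p) ×-dec nonempty? (Out 𝒢 v ∩ R)

  forced? : ∀ R → Decidable (λ v → v ∈ Owned 𝒢 (opponent p) × Out 𝒢 v ⊆ R)
  forced? R v = (v ∈? Owned 𝒢 (opponent p)) ×-dec (Out 𝒢 v ⊆? R)

  attrStep : Subset N → Subset N
  attrStep R = R ∪ (subset (reach? R) ∪ subset (forced? R))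

  attrStage : Subset N → ℕ → Subset N
  attrStage U zero    = U
  attrStage U (suc j) = attrStep (attrStage U j)

  -- The stages increase inside a set of N vertices, so the N-th one is the
  -- union of all of them: see ∈-Attr.
  Attr : Subset N → Subset N
  Attr U = attrStage U N

  private
    grow : ∀ {X Y : Subset N} → X ⊆ Y → Y ≡ X ⊎ ∣ X ∣ < ∣ Y ∣
    grow {X} {Y} X⊆Y with nonempty? (subset (λ v → (v ∈? Y) ×-dec ¬? (v ∈? X)))
    ... | yes (v , v∈) = inj₂ (p⊂q⇒∣p∣<∣q∣
            (X⊆Y , v , ∈-subset⁻ (λ v → (v ∈? Y) ×-dec ¬? (v ∈? X)) v∈))
    ... | no none = inj₁ (⊆-antisym Y⊆X X⊆Y)
      where
      Y⊆X : Y ⊆ X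
      Y⊆X {v} v∈Y with v ∈? X
      ... | yes v∈X = v∈X
      ... | no  v∉X = contradiction
              (v , ∈-subset⁺ (λ v → (v ∈? Y) ×-dec ¬? (v ∈? X)) (v∈Y , v∉X)) none

    grows : ∀ U j → attrStage U (suc j) ≡ attrStage U j ⊎ j < ∣ attrStage U (suc j) ∣
    grows U zero with grow {U} {attrStep U} (p⊆p∪q _)
    ... | inj₁ eq = inj₁ eq
    ... | inj₂ lt = inj₂ (ℕ.≤-trans (s≤s z≤n) lt)
    grows U (suc j) with grows U j
    ... | inj₁ eq = inj₁ (cong attrStep eq)
    ... | inj₂ lt with grow {attrStage U (suc j)} {attrStage U (suc (suc j))} (p⊆p∪q _)
    ...   | inj₁ eq  = inj₁ eq
    ...   | inj₂ lt′ = inj₂ (ℕ.<-≤-trans (s≤s lt) lt′)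

    stationary : ∀ U → attrStep (Attr U) ≡ Attr U
    stationary U with grows U N
    ... | inj₁ eq = eq
    ... | inj₂ lt = contradiction (∣p∣≤n (attrStage U (suc N))) (ℕ.<⇒≱ lt)

  attrStage⊆Attr : ∀ U j → attrStage U j ⊆ Attr U
  attrStage⊆Attr U j {v} v∈ = subst (v ∈_) (settled j) (embed N v∈)
    where
    settled : ∀ d → attrStage U (d + N) ≡ Attr U
    settled zero    = refl
    settled (suc d) = trans (cong attrStep (settled d)) (stationary U)
    embed : ∀ d → attrStage U j ⊆ attrStage U (j + d)
    embed zero    rewrite ℕ.+-identityʳ j = λ x → x
    embed (suc d) rewrite ℕ.+-suc j d = λ x → p⊆p∪q _ (embed d x)

  ∈-Attr : ∀ U {v} → v ∈ Attr U ⇔ ∃ λ j → v ∈ attrStage U j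
  ∈-Attr U = mk⇔ (N ,_) (λ (j , v∈) → attrStage⊆Attr U j v∈)

  Attr⊆V : ∀ {U} → U ⊆ V 𝒢 → Attr U ⊆ V 𝒢
  Attr⊆V {U} U⊆V = stage⊆V N
    where
    stage⊆V : ∀ j → attrStage U j ⊆ V 𝒢
    stage⊆V zero    v∈ = U⊆V v∈
    stage⊆V (suc j) {v} v∈ with x∈p∪q⁻ (attrStage U j) _ v∈
    ... | inj₁ v∈R = stage⊆V j v∈R
    ... | inj₂ v∈′ with x∈p∪q⁻ (subset (reach? (attrStage U j))) _ v∈′
    ...   | inj₁ r = proj₁ (∈-subset⁻ (λ v → (v ∈? V 𝒢) ×-dec (owner 𝒢 v ≟ₚ p))
                       (proj₁ (∈-subset⁻ (reach? (attrStage U j)) r)))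
    ...   | inj₂ f = proj₁ (∈-subset⁻ (λ v → (v ∈? V 𝒢) ×-dec (owner 𝒢 v ≟ₚ opponent p))
                       (proj₁ (∈-subset⁻ (forced? (attrStage U j)) f)))

----------------------------------------------------------------------
-- Hierarchical graph decomposition

-- The edges into w are listed by their sources.
record IncomingOrder {N} (𝒢 : GameGraph N) : Set where
  field
    incoming  : Fin N → List (Fin N)
    unique    : ∀ w → Unique (incoming w)
    complete  : ∀ {u w} → u ∈ₗ incoming w ⇔ u ∈ In 𝒢 w
    V₂-before-V₁ : ∀ w →
      AllPairs (λ u u′ → owner 𝒢 u ≡ player₁ → owner 𝒢 u′ ≡ player₁) (incoming w)

open IncomingOrder

levelEdge? : ∀ {N} (𝒢 : GameGraph N) (order : IncomingOrder 𝒢) (i : ℕ) (u : Fin N) →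
             Decidable (λ w → w ∈ Out 𝒢 u ×
               (Outdeg 𝒢 u ≤ 2 ^ i ⊎ u ∈ₗ take (2 ^ i) (incoming order w)))
levelEdge? 𝒢 order i u w = (w ∈? Out 𝒢 u) ×-dec
  ((Outdeg 𝒢 u ≤? 2 ^ i) ⊎-dec ∈ₗ-dec _≟_ u (take (2 ^ i) (incoming order w)))

level : ∀ {N} (𝒢 : GameGraph N) → IncomingOrder 𝒢 → ℕ → GameGraph N
level 𝒢 order i = record
  { V       = V 𝒢
  ; Out     = λ u → subset (levelEdge? 𝒢 order i u)
  ; owner   = owner 𝒢
  ; Out-dom = λ {u} e → Out-dom 𝒢 (proj₁ (∈-subset⁻ (levelEdge? 𝒢 order i u) e))
  ; Out-cod = λ {u} e → Out-cod 𝒢 (proj₁ (∈-subset⁻ (levelEdge? 𝒢 order i u) e))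
  }

----------------------------------------------------------------------
-- Algorithm GenBuchiGame

topLevel : ℕ → ℕ
topLevel n = 1 ⊔ ⌈log₂ n ⌉

private
  n≤2^⌈log₂n⌉ : ∀ n → n ≤ 2 ^ ⌈log₂ n ⌉
  n≤2^⌈log₂n⌉ = <-rec _ bound
    where
    open ℕ.≤-Reasoning
    bound : ∀ n → (∀ {m} → m < n → m ≤ 2 ^ ⌈log₂ m ⌉) → n ≤ 2 ^ ⌈log₂ n ⌉
    bound 0 _ = z≤n
    bound 1 _ = s≤s z≤n
    bound n@(suc (suc m)) rec = begin
      n                   ≡⟨ ℕ.⌊n/2⌋+⌈n/2⌉≡n n ⟨
      ⌊ n /2⌋ + h         ≤⟨ ℕ.+-monoˡ-≤ h (ℕ.⌊n/2⌋≤⌈n/2⌉ n) ⟩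
      h + h               ≡⟨ cong (h +_) (ℕ.+-identityʳ h) ⟨
      2 * h               ≤⟨ ℕ.*-monoʳ-≤ 2 (rec (ℕ.⌈n/2⌉<n m)) ⟩
      2 ^ suc ⌈log₂ h ⌉   ≡⟨ cong (2 ^_) log-h ⟩
      2 ^ ⌈log₂ n ⌉       ∎
      where
      h : ℕ
      h = ⌈ n /2⌉
      1≤log : 1 ≤ ⌈log₂ n ⌉
      1≤log = subst (_≤ ⌈log₂ n ⌉) (⌈log₂2^n⌉≡n 1) (⌈log₂⌉-mono-≤ {2} {n} (s≤s (s≤s z≤n)))
      log-h : suc ⌈log₂ h ⌉ ≡ ⌈log₂ n ⌉
      log-h = trans (cong suc (⌈log₂⌈n/2⌉⌉≡⌈log₂n⌉∸1 n)) (ℕ.m+[n∸m]≡n 1≤log)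

topLevel-least : ∀ n →
  (1 ≤ topLevel n × n ≤ 2 ^ topLevel n) ×
  (∀ i → 1 ≤ i → n ≤ 2 ^ i → topLevel n ≤ i)
topLevel-least n =
  ( ℕ.m≤m⊔n 1 ⌈log₂ n ⌉
  , ℕ.≤-trans (n≤2^⌈log₂n⌉ n) (ℕ.^-monoʳ-≤ 2 (ℕ.m≤n⊔m 1 ⌈log₂ n ⌉)) ) ,
  λ i 1≤i n≤2^i → ℕ.⊔-lub 1≤i
    (subst (⌈log₂ n ⌉ ≤_) (⌈log₂2^n⌉≡n i) (⌈log₂⌉-mono-≤ n≤2^i))

-- The empty set if the list has no nonempty member.
firstNonempty : ∀ {N} → List (Subset N) → Subset N
firstNonempty []       = ⊥
firstNonempty (X ∷ Xs) with nonempty? X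
... | yes _ = X
... | no  _ = firstNonempty Xs

-- The decomposition uses, for every game graph, an arbitrary admissible order
-- of its incoming edges.
module GenBuchiGame {N k : ℕ} (order : (𝒢 : GameGraph N) → IncomingOrder 𝒢)
                    (𝒢 : GameGraph N) (T : Fin k → Subset N) where

  I : ℕ
  I = topLevel ∣ V 𝒢 ∣

  module Iteration (𝒢ʲ : GameGraph N) (Tʲ : Fin k → Subset N) where

    𝒢ᵢ : ℕ → GameGraph N
    𝒢ᵢ i = level 𝒢ʲ (order 𝒢ʲ) i

    Z : ℕ → Subset N
    Z i = subset (λ v → (v ∈? Owned 𝒢ʲ player₂) ×-dec (Outdeg (𝒢ᵢ i) v ℕ.≟ 0))
        ∪ subset (λ v → (v ∈? Owned 𝒢ʲ player₁) ×-dec (2 ^ i <? Outdeg 𝒢ʲ v))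

    Y : Fin k → ℕ → Subset N
    Y ℓ i = Attr player₁ (𝒢ᵢ i) (Tʲ ℓ ∪ Z i)

    -- Candidates in the order of the two loops: i = 1, …, I outside, ℓ inside.
    S : Subset N
    S = firstNonempty
          (cartesianProductWith (λ i ℓ → V 𝒢ʲ ─ Y ℓ i) (applyUpTo suc I) (allFin k))

    D : Subset N
    D = Attr player₂ 𝒢ʲ S

  -- Iterations are counted from 0 instead of 1.
  graph   : ℕ → GameGraph N
  targets : ℕ → Fin k → Subset N
  removed : ℕ → Subset N

  graph zero    = 𝒢
  graph (suc j) = graph j ∖ removed j

  targets zero      = T
  targets (suc j) ℓ = targets j ℓ ─ removed j

  removed j = Iteration.D (graph j) (targets j)

  StopsAt : ℕ → Set
  StopsAt j = Empty (removed j) × (∀ i → i < j → Nonempty (removed i))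

  private
    firstNonempty⊆ : ∀ {W : Subset N} {Xs} → All (_⊆ W) Xs → firstNonempty Xs ⊆ W
    firstNonempty⊆ [] v∈ = contradiction v∈ ∉⊥
    firstNonempty⊆ {Xs = X ∷ _} (X⊆W ∷ rest) with nonempty? X
    ... | yes _ = X⊆W
    ... | no  _ = firstNonempty⊆ rest

    removed⊆V : ∀ j → removed j ⊆ V (graph j)
    removed⊆V j = Attr⊆V player₂ (graph j) (firstNonempty⊆
      (cartesianProductWith⁺ (setoid ℕ) (setoid (Fin k)) _ (applyUpTo suc I) (allFin k)
        (λ {i} {ℓ} _ _ → p─q⊆p (V (graph j)) (Iteration.Y (graph j) (targets j) ℓ i))))

    search : ∀ m j → ∣ V (graph j) ∣ < m → (∀ i → i < j → Nonempty (removed i)) → ∃ StopsAt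
    search (suc m) j (s≤s V≤m) before with nonempty? (removed j)
    ... | no  empty       = j , empty , before
    ... | yes (v , v∈D) = search m (suc j) (ℕ.<-≤-trans smaller V≤m) before′
      where
      smaller : ∣ V (graph (suc j)) ∣ < ∣ V (graph j) ∣
      smaller = p∩q≢∅⇒∣p─q∣<∣p∣ (V (graph j)) (removed j)
                  (v , x∈p∩q⁺ (removed⊆V j v∈D , v∈D))
      before′ : ∀ i → i < suc j → Nonempty (removed i)
      before′ i (s≤s i≤j) with ℕ.m≤n⇒m<n∨m≡n i≤j
      ... | inj₁ i<j  = before i i<j
      ... | inj₂ refl = v , v∈D

  stops : ∃ StopsAt
  stops = search (suc ∣ V 𝒢 ∣) 0 ℕ.≤-refl (λ _ ())

{-# OPTIONS --safe #-}

-- A set S^j left over by the algorithm is a trap for player 1 in 𝒢^j that misses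
-- some target T_ℓ, although it is computed in the sparser graph 𝒢^j_i: its
-- player-1 vertices have outdegree at most 2^i, so none of their edges is missing
-- there.  In 𝒢 player 1 can leave 𝒢^j only towards sets D^i with i < j that were
-- removed before, so the player-2 strategies (stay in S^j, attract to S^j)
-- combine to a positional one along which every play ends up in a single S^j.
module Submission where

open import Defs
open import Axiom.ExcludedMiddle using (ExcludedMiddle)
open import Data.Fin.Base using (Fin)
open import Data.Fin.Subset using (Subset; _∈_; _∉_; _⊆_; _∩_; _∪_; _─_; ⊥; inside; outside)
open import Data.Fin.Subset.Properties
  using ( _∈?_; nonempty?; x∈p∪q⁻; x∈p∪q⁺; x∈p∩q⁺; x∈p∩q⁻; p─q⊆p
        ; x∈p∧x∉q⇒x∈p─q; ∉⊥)
open import Data.Bool.Properties using (∧-zeroʳ)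
open import Data.List.Base using (List; []; _∷_; allFin; applyUpTo)
open import Data.List.Membership.Propositional using () renaming (_∈_ to _∈ₗ_)
open import Data.List.Membership.Propositional.Properties using (∈-cartesianProductWith⁻)
open import Data.List.Relation.Unary.Any using (here; there)
open import Data.Nat.Base using (ℕ; zero; suc; _+_; _∸_; _≤_; _<_; _^_)
import Data.Nat.Properties as ℕ
open import Data.Product.Base using (Σ-syntax; _×_; _,_; ∃; proj₁; proj₂)
open import Data.Sum.Base as Sum using (_⊎_; inj₁; inj₂)
open import Data.Vec.Base using ([]; _∷_)
open import Function.Base using (id; _∘_)
open import Level using (0ℓ)
open import Relation.Binary.PropositionalEquality
open import Relation.Nullary using (¬_; Dec; yes; no; contradiction)
open import Relation.Nullary.Decidable using (_×-dec_)
open import Relation.Unary using (Pred; ∅)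
import Relation.Unary as U

open GameGraph

-- Finite sets and players.

x∈p─q⇒x∉q : ∀ {n} {x : Fin n} (p q : Subset n) → x ∈ p ─ q → x ∉ q
x∈p─q⇒x∉q p q x∈ x∈q = ∉⊥ (subst (_ ∈_) (p─q∩q≡⊥ p q) (x∈p∩q⁺ (x∈ , x∈q)))
  where
  p─q∩q≡⊥ : ∀ {n} (p q : Subset n) → (p ─ q) ∩ q ≡ ⊥
  p─q∩q≡⊥ []           []            = refl
  p─q∩q≡⊥ (_ ∷ p)      (inside ∷ q)  = cong (outside ∷_) (p─q∩q≡⊥ p q)
  p─q∩q≡⊥ (s ∷ p)      (outside ∷ q) = cong₂ _∷_ (∧-zeroʳ s) (p─q∩q≡⊥ p q)

firstNonempty-∈ : ∀ {N} (Xs : List (Subset N)) {v} →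
                  v ∈ firstNonempty Xs → firstNonempty Xs ∈ₗ Xs
firstNonempty-∈ []       v∈ = contradiction v∈ ∉⊥
firstNonempty-∈ (X ∷ Xs) v∈ with nonempty? X
... | yes _ = here refl
... | no  _ = there (firstNonempty-∈ Xs v∈)

player-cases : ∀ p → p ≡ player₁ ⊎ p ≡ player₂
player-cases player₁ = inj₁ refl
player-cases player₂ = inj₂ refl

-- One-step control and complements of attractors.

module _ {N} (𝒢 : GameGraph N) where

  ∈-Owned⁺ : ∀ {p u} → u ∈ V 𝒢 → owner 𝒢 u ≡ p → u ∈ Owned 𝒢 p
  ∈-Owned⁺ u∈V own = ∈-subset⁺ (λ v → (v ∈? V 𝒢) ×-dec (owner 𝒢 v ≟ₚ _)) (u∈V , own)

  ∈-Owned⁻ : ∀ {p u} → u ∈ Owned 𝒢 p → u ∈ V 𝒢 × owner 𝒢 u ≡ p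
  ∈-Owned⁻ = ∈-subset⁻ (λ v → (v ∈? V 𝒢) ×-dec (owner 𝒢 v ≟ₚ _))

  -- The controllable predecessor operator of player 2.
  Controls : Pred (Fin N) 0ℓ → Pred (Fin N) 0ℓ
  Controls A u = (owner 𝒢 u ≡ player₁ × (∀ {w} → w ∈ Out 𝒢 u → A w))
               ⊎ (owner 𝒢 u ≡ player₂ × ∃ λ w → w ∈ Out 𝒢 u × A w)

  Controls-⊆ : ∀ {A B} → A U.⊆ B → Controls A U.⊆ Controls B
  Controls-⊆ A⊆B (inj₁ (own , all))       = inj₁ (own , λ e → A⊆B (all e))
  Controls-⊆ A⊆B (inj₂ (own , w , e , a)) = inj₂ (own , w , e , A⊆B a)

  module _ (p : Player) (U : Subset N) {u : Fin N} (u∈V : u ∈ V 𝒢) (u∉Attr : u ∉ Attr p 𝒢 U) where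

    private
      u∉attrStep : u ∉ attrStep p 𝒢 (Attr p 𝒢 U)
      -- `attrStep` of the attractor is stage `suc N`, and every stage lies in `Attr`.
      u∉attrStep = u∉Attr ∘ attrStage⊆Attr p 𝒢 U (suc N)

    ∉-Attr-avoids : owner 𝒢 u ≡ p → ∀ {w} → w ∈ Out 𝒢 u → w ∉ Attr p 𝒢 U
    ∉-Attr-avoids own {w} e w∈Attr = u∉attrStep (x∈p∪q⁺ (inj₂ (x∈p∪q⁺ (inj₁
      (∈-subset⁺ (reach? p 𝒢 _) (∈-Owned⁺ u∈V own , w , x∈p∩q⁺ (e , w∈Attr)))))))

    -- With all successors in the attractor, `u` would be forced into it. This also rules out sinks,
    -- where the inclusion is vacuous; levels of the decomposition may have them.
    ∉-Attr-escapes : owner 𝒢 u ≡ opponent p → ∃ λ w → w ∈ Out 𝒢 u × w ∉ Attr p 𝒢 U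
    ∉-Attr-escapes own with nonempty? (Out 𝒢 u ─ Attr p 𝒢 U)
    ... | yes (w , w∈) = w , p─q⊆p _ _ w∈ , x∈p─q⇒x∉q _ _ w∈
    ... | no  none     = contradiction
            (x∈p∪q⁺ (inj₂ (x∈p∪q⁺ (inj₂
              (∈-subset⁺ (forced? p 𝒢 _) (∈-Owned⁺ u∈V own , all-inside))))))
            u∉attrStep
      where
      all-inside : Out 𝒢 u ⊆ Attr p 𝒢 U
      all-inside {w} e with w ∈? Attr p 𝒢 U
      ... | yes w∈ = w∈
      ... | no  w∉ = contradiction (w , x∈p∧x∉q⇒x∈p─q e w∉) none

-- Induced subgames, and traps computed in a level.

record Induced {N} (ℋ 𝒢 : GameGraph N) : Set where
  field
    same-owner : ∀ u → owner ℋ u ≡ owner 𝒢 u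
    Out-sub    : ∀ {u w} → w ∈ Out ℋ u → w ∈ Out 𝒢 u
    Out-keep   : ∀ {u w} → u ∈ V ℋ → w ∈ V ℋ → w ∈ Out 𝒢 u → w ∈ Out ℋ u

open Induced

Induced-refl : ∀ {N} {𝒢 : GameGraph N} → Induced 𝒢 𝒢
Induced-refl = record { same-owner = λ _ → refl ; Out-sub = id ; Out-keep = λ _ _ → id }

Induced-∖ : ∀ {N} {ℋ 𝒢 : GameGraph N} X → Induced ℋ 𝒢 → Induced (ℋ ∖ X) 𝒢
Induced-∖ {ℋ = ℋ} X ind = record
  { same-owner = same-owner ind
  ; Out-sub    = λ {u} e → Out-sub ind (proj₁ (∈-subset⁻ (keepEdge? ℋ X u) e))
  ; Out-keep   = λ {u} u∈ w∈ e → ∈-subset⁺ (keepEdge? ℋ X u)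
      ( Out-keep ind (p─q⊆p (V ℋ) X u∈) (p─q⊆p (V ℋ) X w∈) e
      , x∈p─q⇒x∉q (V ℋ) X u∈ , x∈p─q⇒x∉q (V ℋ) X w∈ )
  }

-- At a player-2 vertex the escaping edge survives because a level has only edges of `ℋ`. A player-1
-- vertex outside `W` is outside `U`, so its outdegree is small and the level contains all its
-- edges, which avoid `W`.
level-trap : ∀ {N} (ℋ : GameGraph N) order i (U : Subset N) →
  let W = Attr player₁ (level ℋ order i) U in
  (∀ {u} → u ∈ V ℋ → owner ℋ u ≡ player₁ → 2 ^ i < Outdeg ℋ u → u ∈ U) →
  ∀ {u} → u ∈ V ℋ → u ∉ W → Controls ℋ (_∈ V ℋ ─ W) u
level-trap {N} ℋ order i U large⊆U {u} u∈V u∉W with player-cases (owner ℋ u)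
... | inj₁ own₁ = inj₁ (own₁ , λ {w} e → x∈p∧x∉q⇒x∈p─q (Out-cod ℋ e)
        (∉-Attr-avoids (level ℋ order i) player₁ U u∈V u∉W own₁
          (∈-subset⁺ (levelEdge? ℋ order i u) (e , inj₁ small))))
  where
  small : Outdeg ℋ u ≤ 2 ^ i
  small = ℕ.≮⇒≥ (u∉W ∘ attrStage⊆Attr player₁ (level ℋ order i) U 0 ∘ large⊆U u∈V own₁)
... | inj₂ own₂ with ∉-Attr-escapes (level ℋ order i) player₁ U u∈V u∉W own₂
...   | w , e , w∉ = inj₂ (own₂ , w , e′ , x∈p∧x∉q⇒x∈p─q (Out-cod ℋ e′) w∉)
  where
  e′ : w ∈ Out ℋ u
  e′ = proj₁ (∈-subset⁻ (levelEdge? ℋ order i u) e)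

-- The co-Büchi objective on suffixes.

module _ {N k : ℕ} {T : Fin k → Subset N} where

  -- `Inf` ignores finite prefixes: a visit at time `r` with `t + s ≤ r` is a visit of the suffix at
  -- time `r ∸ s`, which is at least `t`.
  DisjCoBüchi-drop : ∀ s {ω} → DisjCoBüchi T (λ t → ω (t + s)) → DisjCoBüchi T ω
  DisjCoBüchi-drop s (ℓ , avoids) =
    ℓ , λ v (inf , v∈T) → avoids v (shift inf , v∈T)
    where
    shift : ∀ {ω v} → Inf ω v → Inf (λ t → ω (t + s)) v
    shift {ω} inf t with inf (t + s)
    ... | r , t+s≤r , ωr≡v = r ∸ s , ℕ.m+n≤o⇒m≤o∸n t t+s≤r
          , trans (cong ω (ℕ.m∸n+n≡m (ℕ.≤-trans (ℕ.m≤n+m s t) t+s≤r))) ωr≡v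

  DisjCoBüchi-avoid : ∀ ℓ {ω} → (∀ t → ω t ∉ T ℓ) → DisjCoBüchi T ω
  DisjCoBüchi-avoid ℓ avoids = ℓ , λ v (inf , v∈T) →
    let (s , _ , ωs≡v) = inf 0 in avoids s (subst (_∈ T ℓ) (sym ωs≡v) v∈T)

-- Positional winning strategies of player 2 and their extension.

module Positional (em : ExcludedMiddle 0ℓ) {N k : ℕ} (𝒢 : GameGraph N)
                  (T : Fin k → Subset N) where

  Follows : (Fin N → Fin N) → Fin N → Fin N → Set
  Follows f u w = w ∈ Out 𝒢 u × (owner 𝒢 u ≡ player₂ → w ≡ f u)

  -- `closed` allows an extended strategy to hand a play over for good once it enters `P`. `legal`
  -- ranges beyond `P` because a `Strategy` must move legally everywhere.
  record PositionalWin (P : Pred (Fin N) 0ℓ) : Set where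
    field
      choice : Fin N → Fin N
      legal  : ∀ {u} → u ∈ Owned 𝒢 player₂ → choice u ∈ Out 𝒢 u
      closed : ∀ {u w} → P u → Follows choice u w → P w
      wins   : ∀ ω → P (ω 0) → (∀ t → Follows choice (ω t) (ω (suc t))) → DisjCoBüchi T ω

  open PositionalWin

  -- The winning region of the strategy may be larger than X, and all of it is left
  -- to the old strategy when the region is extended.
  Winnable : Pred (Fin N) 0ℓ → Set₁
  Winnable X = ∃ λ P → (X U.⊆ P) × PositionalWin P

  Winnable-⊆ : ∀ {X Y} → X U.⊆ Y → Winnable Y → Winnable X
  Winnable-⊆ X⊆Y (P , Y⊆P , win) = P , Y⊆P ∘ X⊆Y , win

  -- Start of the construction: absence of sinks yields legal moves, which later extensions inherit
  -- wherever they set no move of their own.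
  Winnable-∅ : NoSinks 𝒢 → Winnable ∅
  Winnable-∅ noSinks = ∅ , id , record
    { choice = λ u → proj₁ (successor u)
    ; legal  = λ {u} u∈ → proj₂ (successor u) (proj₁ (∈-Owned⁻ 𝒢 u∈))
    ; closed = λ ()
    ; wins   = λ _ ()
    }
    where
    successor : ∀ u → ∃ λ w → u ∈ V 𝒢 → w ∈ Out 𝒢 u
    successor u with u ∈? V 𝒢
    ... | yes u∈V = let (w , e) = noSinks u∈V in w , λ _ → e
    ... | no  u∉V = u , λ u∈V → contradiction u∈V u∉V

  -- A play from `P ∪ Q` either reaches `P`, where `old` wins a suffix, or is kept by the new moves
  -- in `A` outside `P` from its second vertex on, where `staying` applies. A trap is adjoined with
  -- `A` equal to `P ∪ Q`, an attractor step with `A` equal to `P`.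
  module _ {P A Q : Pred (Fin N) 0ℓ} (old : PositionalWin P)
           (Q-controls : ∀ {u} → Q u → Controls 𝒢 A u) (A⊆P∪Q : A U.⊆ (P U.∪ Q))
           (staying : ∀ ω → (∀ t → A (ω t) × ¬ P (ω t)) → DisjCoBüchi T ω) where

    private
      choose : ∀ u → ∃ λ w →
        (P u → w ≡ choice old u) ×
        (¬ P u → owner 𝒢 u ≡ player₂ → Controls 𝒢 A u → A w) ×
        (u ∈ Owned 𝒢 player₂ → w ∈ Out 𝒢 u)
      choose u with em {P u} | em {∃ λ w → w ∈ Out 𝒢 u × A w}
      ... | yes Pu | _               = choice old u , (λ _ → refl)
                                     , (λ ¬Pu → contradiction Pu ¬Pu) , legal old
      ... | no ¬Pu | yes (w , e , a) = w , (λ Pu → contradiction Pu ¬Pu)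
                                     , (λ _ _ _ → a) , λ _ → e
      -- The old move serves only as a legal default: without a successor in `A`, player 2 does not
      -- control `A` from here.
      ... | no ¬Pu | no none         = choice old u , (λ _ → refl) , stuck , legal old
        where
        stuck : ¬ P u → owner 𝒢 u ≡ player₂ → Controls 𝒢 A u → A (choice old u)
        stuck _ own (inj₁ (own₁ , _)) with () ← trans (sym own₁) own
        stuck _ _   (inj₂ (_ , w))    = contradiction w none

      f : Fin N → Fin N
      f u = proj₁ (choose u)

      old-follows : ∀ {u w} → P u → Follows f u w → Follows (choice old) u w
      old-follows {u} Pu (e , w≡) = e , λ own → trans (w≡ own) (proj₁ (proj₂ (choose u)) Pu)

      into-A : ∀ {u w} → Q u → ¬ P u → Follows f u w → A w
      into-A {u} Qu ¬Pu (e , w≡) with Q-controls Qu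
      ... | inj₁ (_ , all)   = all e
      ... | c@(inj₂ (own , _)) =
        subst A (sym (w≡ own)) (proj₁ (proj₂ (proj₂ (choose u))) ¬Pu own c)

      f-closed : ∀ {u w} → (P U.∪ Q) u → Follows f u w → (P U.∪ Q) w
      f-closed     (inj₁ Pu) fol = inj₁ (closed old Pu (old-follows Pu fol))
      f-closed {u} (inj₂ Qu) fol = by-cases em
        where
        by-cases : Dec (P u) → _
        -- `P` and `Q` may overlap; there the old choice has priority.
        by-cases (yes Pu) = inj₁ (closed old Pu (old-follows Pu fol))
        by-cases (no ¬Pu) = A⊆P∪Q (into-A Qu ¬Pu fol)

      f-wins : ∀ ω → (P U.∪ Q) (ω 0) → (∀ t → Follows f (ω t) (ω (suc t))) → DisjCoBüchi T ω
      f-wins ω P∪Q₀ fol with em {∃ λ s → P (ω s)}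
      ... | yes (s , Pωs) = DisjCoBüchi-drop s (wins old (λ t → ω (t + s)) Pωs
                              (λ t → old-follows (stays-in-P t) (fol (t + s))))
        where
        stays-in-P : ∀ t → P (ω (t + s))
        stays-in-P zero    = Pωs
        stays-in-P (suc t) = closed old (stays-in-P t) (old-follows (stays-in-P t) (fol (t + s)))
      -- The first vertex is only known to lie in `Q`; membership in `A` begins one step later.
      ... | no never = DisjCoBüchi-drop 1 (staying (λ t → ω (t + 1)) λ t →
              subst (λ s → A (ω s) × ¬ P (ω s)) (ℕ.+-comm 1 t)
                (into-A (in-Q t) (λ p → never (t , p)) (fol t) , λ p → never (suc t , p)))
        where
        in-P∪Q : ∀ t → (P U.∪ Q) (ω t)
        in-P∪Q zero    = P∪Q₀
        in-P∪Q (suc t) = f-closed (in-P∪Q t) (fol t)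
        in-Q : ∀ t → Q (ω t)
        in-Q t with in-P∪Q t
        ... | inj₁ p = contradiction (t , p) never
        ... | inj₂ q = q

    extend : PositionalWin (P U.∪ Q)
    extend = record
      { choice = f
      ; legal  = λ {u} → proj₂ (proj₂ (proj₂ (choose u)))
      ; closed = f-closed
      ; wins   = f-wins
      }

  -- Winning regions carried from a subgame to the whole game.

  Outside : GameGraph N → Pred (Fin N) 0ℓ
  Outside ℋ u = u ∈ V 𝒢 × u ∉ V ℋ

  module _ {ℋ : GameGraph N} (ind : Induced ℋ 𝒢) where

    -- By `Out-keep`, an edge from `V ℋ` that is missing in `ℋ` must leave `V ℋ`, so the additional
    -- moves of player 1 all end in `Outside ℋ`.
    Controls-lift : ∀ {A u} → u ∈ V ℋ → Controls ℋ A u → Controls 𝒢 (Outside ℋ U.∪ A) u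
    Controls-lift {A} {u} u∈ (inj₁ (own , all)) = inj₁ (trans (sym (same-owner ind u)) own , go)
      where
      go : ∀ {w} → w ∈ Out 𝒢 u → (Outside ℋ U.∪ A) w
      go {w} e with w ∈? V ℋ
      ... | yes w∈ = inj₂ (all (Out-keep ind u∈ w∈ e))
      ... | no  w∉ = inj₁ (Out-cod 𝒢 e , w∉)
    Controls-lift {u = u} u∈ (inj₂ (own , w , e , a)) =
      inj₂ (trans (sym (same-owner ind u)) own , w , Out-sub ind e , inj₂ a)

    -- Player 1 can leave `S` only into `Outside ℋ`, which is already won; a play that never enters
    -- `P` stays in `S` and misses `T ℓ`.
    Winnable-trap : ∀ {S} ℓ → (∀ {u} → u ∈ S → u ∈ V ℋ × Controls ℋ (_∈ S) u × u ∉ T ℓ) →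
                    Winnable (Outside ℋ) → Winnable (Outside ℋ U.∪ (_∈ S))
    Winnable-trap {S} ℓ trap (P , out⊆P , win) =
      P U.∪ (_∈ S) , grown , extend {A = P U.∪ (_∈ S)} win controls id staying
      where
      grown : (Outside ℋ U.∪ (_∈ S)) U.⊆ (P U.∪ (_∈ S))
      grown = Sum.map₁ out⊆P
      controls : ∀ {u} → u ∈ S → Controls 𝒢 (P U.∪ (_∈ S)) u
      controls u∈S = let (u∈V , c , _) = trap u∈S in Controls-⊆ 𝒢 grown (Controls-lift u∈V c)
      staying : ∀ ω → (∀ t → (P U.∪ (_∈ S)) (ω t) × ¬ P (ω t)) → DisjCoBüchi T ω
      staying ω stay = DisjCoBüchi-avoid ℓ λ t → avoid (stay t)
        where
        avoid : ∀ {u} → (P U.∪ (_∈ S)) u × ¬ P u → u ∉ T ℓ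
        avoid (inj₁ p , ¬p) = contradiction p ¬p
        avoid (inj₂ s , _)  = proj₂ (proj₂ (trap s))

    Winnable-attrStep : ∀ {R} → Winnable (Outside ℋ U.∪ (_∈ R)) →
                        Winnable (Outside ℋ U.∪ (_∈ attrStep player₂ ℋ R))
    Winnable-attrStep {R} (P , out∪R⊆P , win) =
      P U.∪ Q , split
      -- Every move from `Q` outside `P` enters `P`, so the premise of `staying` is contradictory
      -- already at time 0.
      , extend {A = P} win controls inj₁ (λ ω stay → contradiction (proj₁ (stay 0)) (proj₂ (stay 0)))
      where
      Q : Pred (Fin N) 0ℓ
      Q u = u ∈ V ℋ × Controls ℋ (_∈ R) u
      controls : ∀ {u} → Q u → Controls 𝒢 P u
      controls (u∈V , c) = Controls-⊆ 𝒢 out∪R⊆P (Controls-lift u∈V c)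
      split : (Outside ℋ U.∪ (_∈ attrStep player₂ ℋ R)) U.⊆ (P U.∪ Q)
      split (inj₁ out) = inj₁ (out∪R⊆P (inj₁ out))
      split (inj₂ u∈) with x∈p∪q⁻ R _ u∈
      ... | inj₁ u∈R = inj₁ (out∪R⊆P (inj₂ u∈R))
      ... | inj₂ u∈′ with x∈p∪q⁻ (subset (reach? player₂ ℋ R)) _ u∈′
      ...   | inj₁ r =
        let (own , w , w∈) = ∈-subset⁻ (reach? player₂ ℋ R) r
            (u∈V , own₂)   = ∈-Owned⁻ ℋ own
            (e , w∈R)      = x∈p∩q⁻ _ R w∈
        in inj₂ (u∈V , inj₂ (own₂ , w , e , w∈R))
      ...   | inj₂ f =
        let (own , out⊆R) = ∈-subset⁻ (forced? player₂ ℋ R) f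
            (u∈V , own₁)  = ∈-Owned⁻ ℋ own
        in inj₂ (u∈V , inj₁ (own₁ , λ e → out⊆R e))

    -- One extension per stage: moves fixed at earlier stages are kept, which replaces a rank
    -- function.
    Winnable-Attr : ∀ {U} → Winnable (Outside ℋ U.∪ (_∈ U)) →
                    Winnable (Outside ℋ U.∪ (_∈ Attr player₂ ℋ U))
    Winnable-Attr {U} win = stage N
      where
      stage : ∀ j → Winnable (Outside ℋ U.∪ (_∈ attrStage player₂ ℋ U j))
      stage zero    = win
      stage (suc j) = Winnable-attrStep (stage j)

  toStrategy : ∀ {P v} → PositionalWin P → P v →
               Σ[ σ ∈ Strategy 𝒢 player₂ ] WinningFrom T v σ
  toStrategy {P} win Pv =
    record { move = λ _ → choice win ; legal = λ _ → legal win } ,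
    λ ω play consistent → wins win ω (subst P (sym (IsPlay.start play)) Pv)
      λ t → IsPlay.step play t
          , λ own → consistent t (∈-Owned⁺ 𝒢 (Out-dom 𝒢 (IsPlay.step play t)) own)

-- The iterations of the algorithm.

module _ (em : ExcludedMiddle 0ℓ) {N k : ℕ} (𝒢 : GameGraph N) (noSinks : NoSinks 𝒢)
         (T : Fin k → Subset N) (order : (ℋ : GameGraph N) → IncomingOrder ℋ) where

  open Positional em 𝒢 T
  open GenBuchiGame order 𝒢 T

  graph-induced : ∀ j → Induced (graph j) 𝒢
  graph-induced zero    = Induced-refl
  graph-induced (suc j) = Induced-∖ (removed j) (graph-induced j)

  -- A target shrinks only by vertices that leave the graph too. Hence avoiding the current target
  -- within `graph j` means avoiding the original one.
  targets-complete : ∀ j {ℓ u} → u ∈ V (graph j) → u ∈ T ℓ → u ∈ targets j ℓ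
  targets-complete zero    _  u∈T = u∈T
  targets-complete (suc j) u∈ u∈T =
    x∈p∧x∉q⇒x∈p─q (targets-complete j (p─q⊆p (V (graph j)) _ u∈) u∈T)
                  (x∈p─q⇒x∉q (V (graph j)) _ u∈)

  module _ (j : ℕ) where

    open Iteration (graph j) (targets j)

    -- A member of `S` excludes the default `⊥` of `firstNonempty`, so `S` is then a listed
    -- candidate and its indices can be recovered.
    S-cases : (∃ λ i → ∃ λ ℓ → S ≡ V (graph j) ─ Y ℓ i) ⊎ (∀ {u} → u ∉ S)
    S-cases with nonempty? S
    ... | no  empty   = inj₂ λ u∈ → empty (_ , u∈)
    ... | yes (_ , u∈)
      with i , ℓ , _ , _ , eq ← ∈-cartesianProductWith⁻ (λ i ℓ → V (graph j) ─ Y ℓ i)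
                                  (applyUpTo suc I) (allFin k) (firstNonempty-∈ _ u∈)
      = inj₁ (i , ℓ , eq)

    -- Stage 0 of the attractor supplies both facts: `Z i` contains the player-1 vertices of large
    -- outdegree, and the current target contains what remains of `T ℓ`.
    S-trap : ∀ i ℓ {u} → u ∈ V (graph j) ─ Y ℓ i →
             u ∈ V (graph j) × Controls (graph j) (_∈ V (graph j) ─ Y ℓ i) u × u ∉ T ℓ
    S-trap i ℓ {u} u∈S = u∈V , level-trap (graph j) (order (graph j)) i _ large⊆U u∈V u∉Y , u∉T
      where
      u∈V : u ∈ V (graph j)
      u∈V = p─q⊆p (V (graph j)) _ u∈S
      u∉Y : u ∉ Y ℓ i
      u∉Y = x∈p─q⇒x∉q (V (graph j)) _ u∈S
      large⊆U : ∀ {w} → w ∈ V (graph j) → owner (graph j) w ≡ player₁ →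
                2 ^ i < Outdeg (graph j) w → w ∈ targets j ℓ ∪ Z i
      large⊆U w∈V own large = x∈p∪q⁺ (inj₂ (x∈p∪q⁺ (inj₂
        (∈-subset⁺ (λ v → (v ∈? Owned (graph j) player₁) ×-dec (2 ^ i ℕ.<? Outdeg (graph j) v))
          (∈-Owned⁺ (graph j) w∈V own , large)))))
      u∉T : u ∉ T ℓ
      u∉T u∈T = u∉Y (attrStage⊆Attr player₁ (𝒢ᵢ i) _ 0
                       (x∈p∪q⁺ (inj₁ (targets-complete j u∈V u∈T))))

    Winnable-S : Winnable (Outside (graph j)) → Winnable (Outside (graph j) U.∪ (_∈ S))
    Winnable-S win with S-cases
    ... | inj₂ empty = Winnable-⊆ (Sum.[ id , (λ u∈ → contradiction u∈ empty) ]) win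
    ... | inj₁ (i , ℓ , eq) = subst (λ S → Winnable (Outside (graph j) U.∪ (_∈ S))) (sym eq)
                                (Winnable-trap (graph-induced j) ℓ (S-trap i ℓ) win)

  -- Loop invariant: each iteration adds first the trap `S`, then the rest of its player-2
  -- attractor, to the vertices removed earlier.
  Winnable-Outside : ∀ j → Winnable (Outside (graph j))
  Winnable-Outside zero    = Winnable-⊆ (λ (u∈ , u∉) → u∉ u∈) (Winnable-∅ noSinks)
  Winnable-Outside (suc j) =
    Winnable-⊆ split (Winnable-Attr (graph-induced j) (Winnable-S j (Winnable-Outside j)))
    where
    split : Outside (graph (suc j)) U.⊆ (Outside (graph j) U.∪ (_∈ removed j))
    split {u} (u∈V , u∉) with u ∈? removed j
    ... | yes u∈D = inj₂ u∈D
    ... | no  u∉D = inj₁ (u∈V , λ u∈Vʲ → u∉ (x∈p∧x∉q⇒x∈p─q u∈Vʲ u∉D))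

proposition3p7 : ExcludedMiddle 0ℓ →
    ∀ {N k : ℕ} (𝒢 : GameGraph N) → GameGraph.NoSinks 𝒢 →
    (T : Fin k → Subset N) → (∀ ℓ → T ℓ ⊆ GameGraph.V 𝒢) →
    (order : (ℋ : GameGraph N) → IncomingOrder ℋ) →
    ∀ j* → GenBuchiGame.StopsAt order 𝒢 T j* →
    ∀ v → v ∈ GameGraph.V 𝒢 ─ GameGraph.V (GenBuchiGame.graph order 𝒢 T j*) →
    Σ[ σ ∈ Strategy 𝒢 player₂ ] WinningFrom T v σ
proposition3p7 em 𝒢 noSinks T _ order j* _ v v∈
  with _ , out⊆P , win ← Winnable-Outside em 𝒢 noSinks T order j*
  = Positional.toStrategy em 𝒢 T win
      (out⊆P (p─q⊆p (V 𝒢) _ v∈ , x∈p─q⇒x∉q (V 𝒢) _ v∈))
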